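{- For $k\ge 2$ and $m\ge 2$, let $H_{k,m}=(K_m)^{\square k}$ be the Hamming graph. Then $$\mathrm{rw}(H_{k,m})\;\ge\;\frac{m^{k-1}}{9k}.$$
   Context: $K_m$ is the complete graph on $m$ vertices, and $H^{\square k}$ is the $k$-th Cartesian power of $H$: its vertices are $k$-tuples of vertices of $H$, two being adjacent iff they differ in exactly one coordinate and are adjacent in $H$ in that coordinate. Rank-width: for a graph $G=(V,E)$ and $X\subseteq V$, the cut-rank $\rho_G(X)$ is the $\mathbb F_2$-rank of the $0$-$1$ adjacency matrix with rows indexed by $X$ and columns by $V\setminus X$. A rank-decomposition is a pair $(T,L)$ with $T$ a tree with at least two nodes, all of degree 1 or 3, and $L$ a bijection from $V$ to the leaves of $T$; its width is the maximum over edges $e$ of $T$ of $\rho_G$ of the vertex set corresponding to one side of $T-e$. $\mathrm{rw}(G)$ is the minimum width of a rank-decomposition of $G$. -}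

module Defs where

open import Algebra.Bundles using (CommutativeRing)
open import Data.Bool.Base using (Bool; false; _∧_)
open import Data.Bool.Properties using (xor-∧-commutativeRing)
open import Data.Empty using (⊥)
open import Data.Fin.Base using (Fin; zero)
import Data.Fin.Properties as Fin
import Data.Fin.Subset as Subset
open import Data.List.Base using (List; []; _∷_; _∷ʳ_; length)
open import Data.List.Relation.Unary.Linked using (Linked)
open import Data.List.Relation.Unary.Unique.Propositional using (Unique)
open import Data.Nat.Base using (ℕ; zero; suc; _*_; _^_; _≤_; z≤n; s≤s; NonZero; >-nonZero)
open import Data.Nat.Properties using (≤-trans; m*n≢0)
open import Data.Product.Base using (Σ-syntax; ∃; ∃-syntax; _×_; _,_; proj₁; proj₂; uncurry)
open import Data.Product.Function.NonDependent.Propositional using (_×-↔_)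
open import Data.Sum.Base using (_⊎_)
open import Data.Vec.Base using (Vec; []; _∷_; head; tail; lookup; tabulate)
open import Function.Base using (_∘_)
open import Function.Bundles using (_↔_; _⤖_; mk↔ₛ′; Inverse; Bijection)
open import Function.Properties.Inverse using (↔-refl; ↔-sym; ↔-trans; ↔⇒↣)
open import Level using (Level; 0ℓ)
open import Relation.Binary.Construct.Closure.ReflexiveTransitive using (Star)
open import Relation.Binary.Core using (Rel)
open import Relation.Binary.Definitions using (Decidable; DecidableEquality; Irreflexive; Symmetric)
open import Relation.Binary.PropositionalEquality using (_≡_; _≢_; refl; sym)
open import Relation.Nullary.Decidable using (does; ¬?; _×-dec_; _→-dec_)
open import Relation.Nullary.Negation using (¬_)
open import Relation.Unary using (Pred; ∁)

private
  variable
    ℓ : Level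
    A : Set

IsMaximum IsMinimum : (ℕ → Set ℓ) → ℕ → Set ℓ
IsMaximum P n = P n × (∀ m → P m → m ≤ n)
IsMinimum P n = P n × (∀ m → P m → n ≤ m)

-- Finite simple graphs.
record Graph : Set₁ where
  infix 4 _~_ _~?_
  field
    Vertex : Set
    order  : ℕ
    enum   : Vertex ↔ Fin order
    _~_    : Rel Vertex 0ℓ
    _~?_   : Decidable _~_
    ~-sym  : Symmetric _~_
    ~-irr  : Irreflexive _≡_ _~_

  _≟_ : DecidableEquality Vertex
  _≟_ = Fin.inj⇒≟ (↔⇒↣ enum)

  degree : Vertex → ℕ
  degree v = Subset.∣ tabulate (λ i → does (v ~? Inverse.from enum i)) ∣

  IsCycle : List Vertex → Set
  IsCycle []       = ⊥
  IsCycle (u ∷ us) = 3 ≤ length (u ∷ us) × Unique (u ∷ us) × Linked _~_ (u ∷ us ∷ʳ u)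

  Connected : Set
  Connected = ∀ u v → Star _~_ u v

  Acyclic : Set
  Acyclic = ∀ us → ¬ IsCycle us

  IsTree : Set
  IsTree = Vertex × Connected × Acyclic

  Leaf : Set
  Leaf = Σ[ v ∈ Vertex ] degree v ≡ 1

  DeleteEdge : Vertex → Vertex → Rel Vertex 0ℓ
  DeleteEdge a b x y = x ~ y × ¬ (x ≡ a × y ≡ b) × ¬ (x ≡ b × y ≡ a)

complete : ℕ → Graph
complete m = record
  { Vertex = Fin m
  ; order  = m
  ; enum   = ↔-refl
  ; _~_    = _≢_
  ; _~?_   = λ i j → ¬? (i Fin.≟ j)
  ; ~-sym  = λ i≢j j≡i → i≢j (sym j≡i)
  ; ~-irr  = λ i≡j i≢j → i≢j i≡j
  }

Vec-enum : ∀ {n} → A ↔ Fin n → ∀ k → Vec A k ↔ Fin (n ^ k)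
Vec-enum e zero    = mk↔ₛ′ (λ _ → zero) (λ _ → []) (λ { zero → refl }) (λ { [] → refl })
Vec-enum e (suc k) = ↔-trans uncons (↔-trans (e ×-↔ Vec-enum e k) (↔-sym Fin.*↔×))
  where
  uncons : Vec A (suc k) ↔ (A × Vec A k)
  uncons = mk↔ₛ′ (λ xs → head xs , tail xs) (uncurry _∷_) (λ _ → refl) (λ { (_ ∷ _) → refl })

cartesianPower : Graph → ℕ → Graph
cartesianPower H k = record
  { Vertex = Vec H.Vertex k
  ; order  = H.order ^ k
  ; enum   = Vec-enum H.enum k
  ; _~_    = λ x y → ∃[ i ] (lookup x i H.~ lookup y i × (∀ j → j ≢ i → lookup x j ≡ lookup y j))
  ; _~?_   = λ x y → Fin.any? λ i →
               (lookup x i H.~? lookup y i) ×-dec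
               Fin.all? λ j → ¬? (j Fin.≟ i) →-dec (lookup x j H.≟ lookup y j)
  ; ~-sym  = λ { (i , adj , eq) → i , H.~-sym adj , λ j j≢i → sym (eq j j≢i) }
  ; ~-irr  = λ { refl (i , adj , _) → H.~-irr refl adj }
  }
  where module H = Graph H

hamming : ℕ → ℕ → Graph
hamming k m = cartesianPower (complete m) k

-- 𝔽₂ is Bool, with xor as addition and ∧ as multiplication.
open import Algebra.Properties.Semiring.Sum
  (CommutativeRing.semiring xor-∧-commutativeRing) using (sum)

Independent : ∀ {J : Set} {s} → (Fin s → J → Bool) → Set
Independent {s = s} v =
  (c : Fin s → Bool) → (∀ j → sum (λ i → c i ∧ v i j) ≡ false) → ∀ i → c i ≡ false

IsRank : ∀ {I J : Set} → (I → J → Bool) → ℕ → Set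
IsRank {I} M = IsMaximum λ s → Σ[ rows ∈ (Fin s → I) ] Independent (M ∘ rows)

module _ (G : Graph) where
  open Graph G

  IsCutRank : Pred Vertex 0ℓ → ℕ → Set
  IsCutRank X = IsRank {I = ∃ X} {J = ∃ (∁ X)} λ x y → does (proj₁ x ~? proj₁ y)

  record RankDecomposition : Set₁ where
    field
      tree : Graph
    module T = Graph tree
    field
      isTree    : T.IsTree
      twoNodes  : 2 ≤ T.order
      degree1∨3 : ∀ t → T.degree t ≡ 1 ⊎ T.degree t ≡ 3
      leaves    : Vertex ⤖ T.Leaf

    leaf : Vertex → T.Vertex
    leaf v = proj₁ (Bijection.to leaves v)

    -- The vertices of G on a's side of the tree edge ab.
    side : T.Vertex → T.Vertex → Pred Vertex 0ℓ
    side a b v = Star (T.DeleteEdge a b) a (leaf v)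

    IsWidth : ℕ → Set
    IsWidth = IsMaximum λ r → ∃[ a ] ∃[ b ] (a T.~ b × IsCutRank (side a b) r)

  IsRankWidth : ℕ → Set₁
  IsRankWidth = IsMinimum λ w → Σ[ D ∈ RankDecomposition ] RankDecomposition.IsWidth D w

9*k≢0 : ∀ {k} → 2 ≤ k → NonZero (9 * k)
9*k≢0 {k} 2≤k = m*n≢0 9 k {{_}} {{>-nonZero (≤-trans (s≤s z≤n) 2≤k)}}

-- In a rank-decomposition some tree edge leaves at least a third of the n = m^k vertices on
-- each side: from an edge with more than two thirds of the leaves beyond it, keep moving to
-- a heavier branch. Let X be one side of it. Joining x ∈ X to y ∉ X by changing one coordinate
-- at a time crosses a line meeting both X and its complement, whence
-- 4 |X| |Xᶜ| ≤ m^(k+1) · (number of mixed lines). For a fixed direction i choose on each mixed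
-- line a point x of X and a point y outside X. A random subset S of [m] contains xᵢ but not
-- yᵢ with probability 1/4, and the chosen points on the lines for which this happens form an
-- induced matching across the cut, so there are at most 4 ρ(X) mixed lines in direction i.
-- Hence n² ≤ 9 |X| |Xᶜ| ≤ 9 k m^(k+1) ρ(X).
-- The conclusion is decidable, so the decidability of branches and the existence of cut-ranks
-- are needed only under a double negation.
module Submission where

open import Defs
open import Algebra.Bundles using (CommutativeRing)
open import Data.Bool.Base using (Bool; true; false; if_then_else_; _∧_; _xor_)
import Data.Bool.Properties as Bool
open import Algebra.Properties.Semiring.Sum
  (CommutativeRing.semiring Bool.xor-∧-commutativeRing) as 𝔽₂ using ()
open import Data.Fin.Base using (Fin; zero; suc; punchIn)
import Data.Fin.Properties as Fin
open import Data.Fin.Subset using (∣_∣)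
open import Data.List.Base using (List; []; _∷_; _∷ʳ_; _++_; map; length; filter; lookup; allFin; cartesianProductWith)
import Data.List.Membership.DecPropositional as DecMembership
open import Data.List.Membership.Propositional using (_∈_; _∉_; lose)
open import Data.List.Membership.Propositional.Properties using (∈-map⁺; ∈-allFin; ∈-filter⁻; ∈-lookup)
open import Data.List.Properties using (map-++; map-∘; map-tabulate; length-tabulate)
open import Data.List.Relation.Unary.All as All using (All; []; _∷_)
open import Data.List.Relation.Unary.Any as Any using (here; there)
open import Data.List.Relation.Unary.Linked as Linked using (Linked; [-]; _∷_)
open import Data.List.Relation.Unary.Unique.Propositional using (Unique; []; _∷_)
import Data.List.Relation.Unary.Unique.Propositional.Properties as Unique
open import Data.Nat.Base hiding (_/_)
open import Data.Nat.ListAction using (sum)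
open import Data.Nat.ListAction.Properties using (sum-++)
open import Data.Nat.Properties hiding (_≟_)
open import Data.Nat.Solver using (module +-*-Solver)
open import Data.Product.Base using (∃; ∃₂; _×_; _,_; proj₁; proj₂)
open import Data.Sum.Base using (_⊎_; inj₁; inj₂)
open import Data.Vec.Base as Vec using (Vec; []; _∷_; insertAt)
open import Data.Vec.Properties using (∷-injective; insertAt-lookup; insertAt-punchIn; tabulate∘lookup; tabulate-cong)
open import Effect.Monad using (RawMonad)
open import Function.Base using (_∘_)
open import Function.Bundles using (Inverse; Injection; Bijection)
open import Function.Properties.Inverse using (↔⇒↣)
open import Level using (0ℓ)
open import Relation.Binary.Construct.Closure.ReflexiveTransitive using (Star; ε; _◅_; _◅◅_)
open import Relation.Binary.Core using (Rel)
open import Relation.Binary.PropositionalEquality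
open import Relation.Nullary
open import Relation.Nullary.Decidable using (decidable-stable; ¬¬-excluded-middle; dec-true; dec-false)
open import Relation.Nullary.Negation using (¬¬-Monad)
open import Relation.Unary using (Pred; Decidable; ∁; _⊆_)

private variable
  A B C P Q R : Set

-- Finite sums over lists.

∑ : List A → (A → ℕ) → ℕ
∑ xs f = sum (map f xs)

∑-cong : ∀ (xs : List A) {f g : A → ℕ} → f ≗ g → ∑ xs f ≡ ∑ xs g
∑-cong []       f≗g = refl
∑-cong (x ∷ xs) f≗g = cong₂ _+_ (f≗g x) (∑-cong xs f≗g)

∑-mono : ∀ (xs : List A) {f g : A → ℕ} → (∀ x → f x ≤ g x) → ∑ xs f ≤ ∑ xs g
∑-mono []       f≤g = z≤n
∑-mono (x ∷ xs) f≤g = +-mono-≤ (f≤g x) (∑-mono xs f≤g)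

∑-distrib-+ : ∀ (xs : List A) (f g : A → ℕ) → ∑ xs (λ x → f x + g x) ≡ ∑ xs f + ∑ xs g
∑-distrib-+ []       f g = refl
∑-distrib-+ (x ∷ xs) f g rewrite ∑-distrib-+ xs f g =
  solve 4 (λ a b c d → a :+ b :+ (c :+ d) := a :+ c :+ (b :+ d)) refl (f x) (g x) (∑ xs f) (∑ xs g)
  where open +-*-Solver

*-distribˡ-∑ : ∀ (xs : List A) c (f : A → ℕ) → ∑ xs (λ x → c * f x) ≡ c * ∑ xs f
*-distribˡ-∑ []       c f = sym (*-zeroʳ c)
*-distribˡ-∑ (x ∷ xs) c f rewrite *-distribˡ-∑ xs c f = sym (*-distribˡ-+ c (f x) (∑ xs f))

∑-const : ∀ (xs : List A) c → ∑ xs (λ _ → c) ≡ length xs * c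
∑-const []       c = refl
∑-const (x ∷ xs) c = cong (c +_) (∑-const xs c)

∑-zero : ∀ (xs : List A) → ∑ xs (λ _ → 0) ≡ 0
∑-zero xs = trans (∑-const xs 0) (*-zeroʳ (length xs))

∑-swap : ∀ (xs : List A) (ys : List B) (f : A → B → ℕ) →
         ∑ xs (λ x → ∑ ys (f x)) ≡ ∑ ys (λ y → ∑ xs (λ x → f x y))
∑-swap []       ys f = sym (∑-zero ys)
∑-swap (x ∷ xs) ys f rewrite ∑-swap xs ys f = sym (∑-distrib-+ ys (f x) _)

∑-*-∑ : ∀ (xs : List A) (ys : List B) (f : A → ℕ) (g : B → ℕ) →
        ∑ xs f * ∑ ys g ≡ ∑ xs (λ x → ∑ ys (λ y → f x * g y))
∑-*-∑ xs ys f g = begin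
  ∑ xs f * ∑ ys g                        ≡⟨ *-comm (∑ xs f) _ ⟩
  ∑ ys g * ∑ xs f                        ≡⟨ *-distribˡ-∑ xs (∑ ys g) f ⟨
  ∑ xs (λ x → ∑ ys g * f x)              ≡⟨ ∑-cong xs (λ x → *-comm _ (f x)) ⟩
  ∑ xs (λ x → f x * ∑ ys g)              ≡⟨ ∑-cong xs (λ x → *-distribˡ-∑ ys (f x) g) ⟨
  ∑ xs (λ x → ∑ ys (λ y → f x * g y))    ∎
  where open ≡-Reasoning

∑-map : ∀ (h : A → B) xs (f : B → ℕ) → ∑ (map h xs) f ≡ ∑ xs (f ∘ h)
∑-map h xs f = cong sum (sym (map-∘ xs))

∑-++ : ∀ (xs ys : List A) (f : A → ℕ) → ∑ (xs ++ ys) f ≡ ∑ xs f + ∑ ys f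
∑-++ xs ys f = trans (cong sum (map-++ f xs ys)) (sum-++ (map f xs) (map f ys))

∑-cartesianProductWith : ∀ (h : A → B → C) xs ys (f : C → ℕ) →
  ∑ (cartesianProductWith h xs ys) f ≡ ∑ xs (λ x → ∑ ys (λ y → f (h x y)))
∑-cartesianProductWith h []       ys f = refl
∑-cartesianProductWith h (x ∷ xs) ys f =
  trans (∑-++ (map (h x) ys) _ f) (cong₂ _+_ (∑-map (h x) ys f) (∑-cartesianProductWith h xs ys f))

∑-allFin-suc : ∀ n (f : Fin (suc n) → ℕ) → ∑ (allFin (suc n)) f ≡ f zero + ∑ (allFin n) (f ∘ suc)
∑-allFin-suc n f = cong (f zero +_) (cong sum (trans (map-tabulate suc f) (sym (map-tabulate (λ i → i) (f ∘ suc)))))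

∈⇒≤∑ : ∀ {xs : List A} {x} (f : A → ℕ) → x ∈ xs → f x ≤ ∑ xs f
∈⇒≤∑ f (here refl)            = m≤m+n _ _
∈⇒≤∑ f (there {x = y} x∈xs) = m≤n⇒m≤o+n (f y) (∈⇒≤∑ f x∈xs)

-- Indicators of decidable propositions.

χ : Dec P → ℕ
χ P? = if does P? then 1 else 0

χ-mono : (P? : Dec P) (Q? : Dec Q) → (P → Q) → χ P? ≤ χ Q?
χ-mono (no _)  _       _   = z≤n
χ-mono (yes p) (yes _) _   = ≤-refl
χ-mono (yes p) (no ¬q) p⇒q = contradiction (p⇒q p) ¬q

χ-true : (P? : Dec P) → P → χ P? ≡ 1
χ-true (yes _) _ = refl
χ-true (no ¬p) p = contradiction p ¬p

χ-false : (P? : Dec P) → ¬ P → χ P? ≡ 0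
χ-false (yes p) ¬p = contradiction p ¬p
χ-false (no _)  _  = refl

χ-disjoint : (P? : Dec P) (Q? : Dec Q) (R? : Dec R) →
             (P → R) → (Q → R) → (P → ¬ Q) → χ P? + χ Q? ≤ χ R?
χ-disjoint (no _)  Q?      R? _   q⇒r _   = χ-mono Q? R? q⇒r
χ-disjoint (yes p) (yes q) _  _   _   p⇒¬q = contradiction q (p⇒¬q p)
χ-disjoint (yes p) (no _)  R? p⇒r _   _   = ≤-reflexive (sym (χ-true R? (p⇒r p)))

χ-× : (P? : Dec P) (Q? : Dec Q) → χ (P? ×-dec Q?) ≡ χ P? * χ Q?
χ-× (no _)  _       = refl
χ-× (yes _) (yes _) = refl
χ-× (yes _) (no _)  = refl

χ-¬ : (P? : Dec P) → χ P? + χ (¬? P?) ≡ 1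
χ-¬ (yes _) = refl
χ-¬ (no _)  = refl

χ-weighted : (P? : Dec P) {x y : ℕ} → (P → x ≤ y) → χ P? * x ≤ y * χ P?
χ-weighted (no _)  _   = z≤n
χ-weighted (yes p) {x} {y} x≤y = subst₂ _≤_ (sym (*-identityˡ x)) (sym (*-identityʳ y)) (x≤y p)

*χ≤ : (P? : Dec P) {x y : ℕ} → (P → x ≤ y) → x * χ P? ≤ y
*χ≤ (no _)  {x} _   = ≤-trans (≤-reflexive (*-zeroʳ x)) z≤n
*χ≤ (yes p) {x} x≤y = ≤-trans (≤-reflexive (*-identityʳ x)) (x≤y p)

length-filter-∑ : ∀ {P : Pred A _} (P? : Decidable P) xs → length (filter P? xs) ≡ ∑ xs (χ ∘ P?)
length-filter-∑ P? []       = refl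
length-filter-∑ P? (x ∷ xs) with does (P? x)
... | true  = cong suc (length-filter-∑ P? xs)
... | false = length-filter-∑ P? xs

∑χ≤1 : ∀ {P : Pred A _} (P? : Decidable P) {xs} → Unique xs →
       (∀ {x y} → P x → P y → x ≡ y) → ∑ xs (χ ∘ P?) ≤ 1
∑χ≤1 P? []          _    = z≤n
∑χ≤1 {P = P} P? {x ∷ xs} (x∉ ∷ xs!) prop with P? x
... | no _   = ∑χ≤1 P? xs! prop
... | yes px = s≤s (≤-reflexive (none xs x∉))
  where
  none : ∀ ys → All (x ≢_) ys → ∑ ys (χ ∘ P?) ≡ 0
  none []       []          = refl
  none (y ∷ ys) (x≢y ∷ x∉) = cong₂ _+_ (χ-false (P? y) (λ py → x≢y (prop px py))) (none ys x∉)

-- Sums over all vectors of a given length.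

vecs : List A → ∀ k → List (Vec A k)
vecs xs zero    = [] ∷ []
vecs xs (suc k) = cartesianProductWith _∷_ xs (vecs xs k)

∑-vecs-suc : ∀ (xs : List A) k (f : Vec A (suc k) → ℕ) →
             ∑ (vecs xs (suc k)) f ≡ ∑ xs (λ x → ∑ (vecs xs k) (λ v → f (x ∷ v)))
∑-vecs-suc xs k f = ∑-cartesianProductWith _∷_ xs (vecs xs k) f

∑-vecs-const : ∀ (xs : List A) k c → ∑ (vecs xs k) (λ _ → c) ≡ length xs ^ k * c
∑-vecs-const xs zero    c = refl
∑-vecs-const xs (suc k) c = begin
  ∑ (vecs xs (suc k)) (λ _ → c)              ≡⟨ ∑-vecs-suc xs k _ ⟩
  ∑ xs (λ _ → ∑ (vecs xs k) (λ _ → c))       ≡⟨ ∑-const xs _ ⟩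
  length xs * ∑ (vecs xs k) (λ _ → c)        ≡⟨ cong (length xs *_) (∑-vecs-const xs k c) ⟩
  length xs * (length xs ^ k * c)            ≡⟨ *-assoc (length xs) _ c ⟨
  length xs ^ suc k * c                      ∎
  where open ≡-Reasoning

vecs-unique : ∀ {xs : List A} → Unique xs → ∀ k → Unique (vecs xs k)
vecs-unique xs! zero    = [] ∷ []
vecs-unique xs! (suc k) = Unique.cartesianProductWith⁺ _∷_ ∷-injective xs! (vecs-unique xs! k)

-- Walks and branches in a tree.

star-closed : ∀ {R : Rel A 0ℓ} {U : Pred A 0ℓ} → (∀ {x y} → R x y → U x → U y) →
              ∀ {x y} → Star R x y → U x → U y
star-closed step ε          ux = ux
star-closed step (r ◅ rs) ux = star-closed step rs (step r ux)

∣tabulate∣ : ∀ n (f : Fin n → Bool) → ∣ Vec.tabulate f ∣ ≡ ∑ (allFin n) (λ i → if f i then 1 else 0)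
∣tabulate∣ zero    f = refl
∣tabulate∣ (suc n) f rewrite ∑-allFin-suc n (λ i → if f i then 1 else 0) with f zero
... | true  = cong suc (∣tabulate∣ n (f ∘ suc))
... | false = ∣tabulate∣ n (f ∘ suc)

module _ (T : Graph) where
  open Graph T
  open DecMembership _≟_ using (_∈?_)

  vertices : List Vertex
  vertices = map (Inverse.from enum) (allFin order)

  ∈-vertices : ∀ t → t ∈ vertices
  ∈-vertices t = subst (_∈ vertices) (Inverse.strictlyInverseʳ enum t) (∈-map⁺ (Inverse.from enum) (∈-allFin _))

  degree-∑ : ∀ t → degree t ≡ ∑ vertices (λ u → χ (t ~? u))
  degree-∑ t = trans (∣tabulate∣ order _) (sym (∑-map (Inverse.from enum) (allFin order) _))

  Branch : Vertex → Vertex → Pred Vertex 0ℓ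
  Branch a b = Star (DeleteEdge a b) a

  ~⇒≢ : ∀ {a b} → a ~ b → a ≢ b
  ~⇒≢ a~b a≡b = ~-irr a≡b a~b

  delete? : ∀ a b {x y} → x ~ y → DeleteEdge a b x y ⊎ (x ≡ a × y ≡ b) ⊎ (x ≡ b × y ≡ a)
  delete? a b {x} {y} x~y with (x ≟ a) ×-dec (y ≟ b) | (x ≟ b) ×-dec (y ≟ a)
  ... | yes p | _     = inj₂ (inj₁ p)
  ... | no _  | yes q = inj₂ (inj₂ q)
  ... | no ¬p | no ¬q = inj₁ (x~y , ¬p , ¬q)

  branch-step : ∀ {a b x y} → Branch a b x → DeleteEdge a b x y → Branch a b y
  branch-step s d = s ◅◅ (d ◅ ε)

  -- The endpoint `b` is kept outside the list so that prepending `b` gives the vertex list of a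
  -- cycle in the form that `IsCycle` expects.
  PathTo : Rel Vertex 0ℓ → Vertex → List Vertex → Set
  PathTo R b us = Linked R (us ∷ʳ b) × Unique us × b ∉ us

  path-suffix : ∀ {R b x us} → x ∈ us → PathTo R b us → ∃ λ vs → PathTo R b (x ∷ vs)
  path-suffix {us = u ∷ us} (here refl) path = us , path
  path-suffix {us = u ∷ v ∷ us} (there x∈) (_ ∷ linked , _ ∷ unique , b∉) =
    path-suffix x∈ (linked , unique , b∉ ∘ there)

  ∉⇒All≢ : ∀ {x : Vertex} {us} → x ∉ us → All (x ≢_) us
  ∉⇒All≢ x∉ = All.tabulate λ y∈ x≡y → x∉ (subst (_∈ _) (sym x≡y) y∈)

  -- Loop erasure: if `x` already lies on the path found for the rest of the walk, only the part
  -- from that occurrence on is kept.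
  shortcut : ∀ {R b x} → Star R x b → x ≡ b ⊎ ∃ λ us → PathTo R b (x ∷ us)
  shortcut ε = inj₁ refl
  shortcut {b = b} {x} (r ◅ rs) with x ≟ b | shortcut rs
  ... | yes x≡b | _ = inj₁ x≡b
  ... | no x≢b | inj₁ refl = inj₂ ([] , r ∷ [-] , [] ∷ [] , λ { (here b≡x) → x≢b (sym b≡x) })
  ... | no x≢b | inj₂ (vs , path@(linked , unique , b∉)) with x ∈? (_ ∷ vs)
  ...   | yes x∈ = inj₂ (path-suffix x∈ path)
  ...   | no x∉  = inj₂ (_ , r ∷ linked , ∉⇒All≢ x∉ ∷ unique ,
                         λ { (here b≡x) → x≢b (sym b≡x) ; (there b∈) → b∉ b∈ })

  -- A path from `a` to `b` that avoids the edge `ab` is closed to a cycle by that edge.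
  acyclic⇒bridge : Acyclic → ∀ {a b} → a ~ b → ¬ Branch a b b
  acyclic⇒bridge acyclic {a} {b} a~b s with shortcut s
  ... | inj₁ a≡b = ~⇒≢ a~b a≡b
  -- A path with no inner vertex would be the deleted edge itself; hence the cycle built below has
  -- at least three vertices.
  ... | inj₂ ([] , (_ , ¬ab , _) ∷ _ , _) = ¬ab (refl , refl)
  ... | inj₂ (c ∷ us , linked , unique , b∉) =
    acyclic (b ∷ a ∷ c ∷ us)
      (s≤s (s≤s (s≤s z≤n)) , ∉⇒All≢ b∉ ∷ unique , ~-sym a~b ∷ Linked.map proj₁ linked)

  -- Inside the branch at `c` a walk cannot return to `b`, because `bc` is a bridge; so it cannot
  -- use the edge `ba` either. The invariant carries both memberships at once.
  branch-⊆ : Acyclic → ∀ {a b c} → b ~ c → c ≢ a → Branch c b ⊆ Branch b a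
  branch-⊆ acyclic {a} {b} {c} b~c c≢a s =
    proj₁ (star-closed step s ((b~c , (c≢a ∘ proj₂) , λ (_ , c≡b) → ~⇒≢ b~c (sym c≡b)) ◅ ε , ε))
    where
    avoids : ∀ {t} → Branch c b t → t ≢ b
    avoids s refl = acyclic⇒bridge acyclic (~-sym b~c) s
    step : ∀ {x y} → DeleteEdge c b x y → Branch b a x × Branch c b x → Branch b a y × Branch c b y
    step d (s , t) =
      branch-step s (proj₁ d , (λ (x≡b , _) → avoids t x≡b) , λ (_ , y≡b) → avoids (branch-step t d) y≡b) ,
      branch-step t d

  -- Once the walk has left `b`, the invariant records an onward neighbour `c` whose branch contains
  -- the current vertex; crossing `cb` either returns to `b` or restarts at `c`.
  branch-split : ∀ {a b t} → Branch b a t → t ≡ b ⊎ ∃ λ c → b ~ c × c ≢ a × Branch c b t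
  branch-split {a} {b} s = star-closed step s (inj₁ refl)
    where
    U : Pred Vertex 0ℓ
    U t = t ≡ b ⊎ ∃ λ c → b ~ c × c ≢ a × Branch c b t
    step : ∀ {x y} → DeleteEdge b a x y → U x → U y
    step (b~y , ¬ba , _) (inj₁ refl) = inj₂ (_ , b~y , (λ y≡a → ¬ba (refl , y≡a)) , ε)
    step (x~y , _) (inj₂ (c , b~c , c≢a , s)) with delete? c b x~y
    ... | inj₁ d                   = inj₂ (c , b~c , c≢a , branch-step s d)
    ... | inj₂ (inj₁ (_ , y≡b))    = inj₁ y≡b
    ... | inj₂ (inj₂ (_ , refl))   = inj₂ (c , b~c , c≢a , ε)

  -- Along a walk from `a` to `t`, crossing the edge lands on an endpoint, which starts its own
  -- branch; every other step stays within the current branch.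
  branch-cover : Connected → ∀ {a b} → a ~ b → ∀ t → Branch a b t ⊎ Branch b a t
  branch-cover connected {a} {b} a~b t = star-closed step (connected a t) (inj₁ ε)
    where
    U : Pred Vertex 0ℓ
    U t = Branch a b t ⊎ Branch b a t
    step : ∀ {x y} → x ~ y → U x → U y
    step x~y u with delete? a b x~y
    ... | inj₂ (inj₁ (_ , refl)) = inj₂ ε
    ... | inj₂ (inj₂ (_ , refl)) = inj₁ ε
    ... | inj₁ d@(_ , ¬p , ¬q) with u
    ...   | inj₁ s = inj₁ (branch-step s d)
    ...   | inj₂ s = inj₂ (branch-step s (x~y , ¬q , ¬p))

  some-edge : Connected → 2 ≤ order → ∃₂ _~_
  some-edge connected (s≤s (s≤s _)) with connected (Inverse.from enum zero) (Inverse.from enum (suc zero))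
  ... | p = first-edge distinct p
    where
    distinct : Inverse.from enum zero ≢ Inverse.from enum (suc zero)
    distinct eq with trans (sym (Inverse.strictlyInverseˡ enum zero)) (trans (cong (Inverse.to enum) eq) (Inverse.strictlyInverseˡ enum (suc zero)))
    ... | ()
    first-edge : ∀ {x y} → x ≢ y → Star _~_ x y → ∃₂ _~_
    first-edge x≢y ε       = contradiction refl x≢y
    first-edge x≢y (e ◅ _) = _ , _ , e

  -- A tree edge with at least a third of the leaves on each side.

  module _ (isTree : IsTree) (2≤order : 2 ≤ order) (degree1∨3 : ∀ t → degree t ≡ 1 ⊎ degree t ≡ 3)
           (branch? : ∀ a b → Decidable (Branch a b))
           {V : Set} (vs : List V) (leaf : V → Vertex) (leaf-degree : ∀ v → degree (leaf v) ≡ 1)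
           (leaf-simple : ∀ t → ∑ vs (λ v → χ (leaf v ≟ t)) ≤ 1)
           (2≤length : 2 ≤ length vs)
           where

    private
      connected = proj₁ (proj₂ isTree)
      acyclic = proj₂ (proj₂ isTree)
      n = length vs

    weight : Vertex → Vertex → ℕ
    weight a b = ∑ vs (λ v → χ (branch? a b (leaf v)))

    -- Counts tree vertices rather than leaves: this is the quantity that drops with every move of
    -- the descent.
    size : Vertex → Vertex → ℕ
    size a b = ∑ vertices (λ t → χ (branch? a b t))

    -- The branch at `c` lies inside the branch at `b` and misses `b` itself.
    size-< : ∀ {a b c} → b ~ c → c ≢ a → size c b < size b a
    size-< {a} {b} {c} b~c c≢a = begin
      suc (size c b)                                            ≡⟨ +-comm 1 _ ⟩
      size c b + 1                                              ≤⟨ +-monoʳ-≤ (size c b) one ⟩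
      size c b + ∑ vertices (λ t → χ (t ≟ b))                   ≡⟨ ∑-distrib-+ vertices _ _ ⟨
      ∑ vertices (λ t → χ (branch? c b t) + χ (t ≟ b))
        ≤⟨ ∑-mono vertices (λ t → χ-disjoint (branch? c b t) (t ≟ b) (branch? b a t)
             (branch-⊆ acyclic b~c c≢a) (λ { refl → ε })
             λ { s refl → acyclic⇒bridge acyclic (~-sym b~c) s }) ⟩
      size b a                                                  ∎
      where
      open ≤-Reasoning
      one : 1 ≤ ∑ vertices (λ t → χ (t ≟ b))
      one = ≤-trans (≤-reflexive (sym (χ-true (b ≟ b) refl))) (∈⇒≤∑ (λ t → χ (t ≟ b)) (∈-vertices b))

    onward? : ∀ a b c → Dec (b ~ c × c ≢ a)
    onward? a b c = (b ~? c) ×-dec ¬? (c ≟ a)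

    -- The neighbour `a` contributes to the degree of `b` but is not onward, which leaves no onward
    -- neighbour at a leaf and at most two at an inner node.
    onward-count : ∀ {a b} → a ~ b → suc (∑ vertices (χ ∘ onward? a b)) ≤ degree b
    onward-count {a} {b} a~b = begin
      suc (∑ vertices (χ ∘ onward? a b))                        ≡⟨ +-comm 1 _ ⟩
      ∑ vertices (χ ∘ onward? a b) + 1                          ≤⟨ +-monoʳ-≤ _ one ⟩
      ∑ vertices (χ ∘ onward? a b) + ∑ vertices (λ t → χ (t ≟ a)) ≡⟨ ∑-distrib-+ vertices _ _ ⟨
      ∑ vertices (λ t → χ (onward? a b t) + χ (t ≟ a))
        ≤⟨ ∑-mono vertices (λ t → χ-disjoint (onward? a b t) (t ≟ a) (b ~? t)
             proj₁ (λ { refl → ~-sym a~b }) proj₂) ⟩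
      ∑ vertices (λ t → χ (b ~? t))                             ≡⟨ degree-∑ b ⟨
      degree b                                                  ∎
      where
      open ≤-Reasoning
      one : 1 ≤ ∑ vertices (λ t → χ (t ≟ a))
      one = ≤-trans (≤-reflexive (sym (χ-true (a ≟ a) refl))) (∈⇒≤∑ (λ t → χ (t ≟ a)) (∈-vertices a))

    -- Union bound over the cases of `branch-split`.
    weight-split : ∀ a b → weight b a ≤
      ∑ vs (λ v → χ (leaf v ≟ b)) + ∑ vertices (λ c → χ (onward? a b c) * weight c b)
    weight-split a b = begin
      weight b a
        ≤⟨ ∑-mono vs pointwise ⟩
      ∑ vs (λ v → χ (leaf v ≟ b) + ∑ vertices (λ c → χ (onward? a b c) * χ (branch? c b (leaf v))))
        ≡⟨ ∑-distrib-+ vs _ _ ⟩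
      ∑ vs (λ v → χ (leaf v ≟ b)) + ∑ vs (λ v → ∑ vertices (λ c → χ (onward? a b c) * χ (branch? c b (leaf v))))
        ≡⟨ cong (∑ vs (λ v → χ (leaf v ≟ b)) +_) (trans (∑-swap vs vertices _)
             (∑-cong vertices λ c → *-distribˡ-∑ vs (χ (onward? a b c)) _)) ⟩
      ∑ vs (λ v → χ (leaf v ≟ b)) + ∑ vertices (λ c → χ (onward? a b c) * weight c b) ∎
      where
      open ≤-Reasoning
      pointwise : ∀ v → χ (branch? b a (leaf v)) ≤
        χ (leaf v ≟ b) + ∑ vertices (λ c → χ (onward? a b c) * χ (branch? c b (leaf v)))
      pointwise v with branch? b a (leaf v)
      ... | no _ = z≤n
      ... | yes s with branch-split s
      ...   | inj₁ leaf≡b = m≤n⇒m≤n+o _ (≤-reflexive (sym (χ-true (leaf v ≟ b) leaf≡b)))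
      ...   | inj₂ (c , b~c , c≢a , s′) = m≤n⇒m≤o+n (χ (leaf v ≟ b)) (begin
        1                                                ≡⟨ cong₂ _*_ (χ-true (onward? a b c) (b~c , c≢a)) (χ-true (branch? c b (leaf v)) s′) ⟨
        χ (onward? a b c) * χ (branch? c b (leaf v))     ≤⟨ ∈⇒≤∑ (λ c → χ (onward? a b c) * χ (branch? c b (leaf v))) (∈-vertices c) ⟩
        _                                                ∎)

    -- If no branch beyond b carried a third of the leaves, then b's own branch would
    -- carry at most two thirds of them.
    heavy-onward : ∀ {a b} → a ~ b → 2 * n < 3 * weight b a →
                   ∃ λ c → (b ~ c × c ≢ a) × n ≤ 3 * weight c b
    heavy-onward {a} {b} a~b heavy
      with Any.any? (λ c → onward? a b c ×-dec (n ≤? 3 * weight c b)) vertices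
    ... | yes found = Any.satisfied found
    ... | no none   = contradiction heavy (≤⇒≯ (light (degree1∨3 b)))
      where
      open ≤-Reasoning
      onward = ∑ vertices (χ ∘ onward? a b)
      here-leaves = ∑ vs (λ v → χ (leaf v ≟ b))

      small : ∀ c → χ (onward? a b c) * (3 * weight c b) ≤ n * χ (onward? a b c)
      small c = χ-weighted (onward? a b c) λ p →
        <⇒≤ (≰⇒> λ big → none (lose (∈-vertices c) (p , big)))

      bound : 3 * weight b a ≤ 3 * here-leaves + n * onward
      bound = begin
        3 * weight b a
          ≤⟨ *-monoʳ-≤ 3 (weight-split a b) ⟩
        3 * (here-leaves + ∑ vertices (λ c → χ (onward? a b c) * weight c b))
          ≡⟨ *-distribˡ-+ 3 here-leaves _ ⟩
        3 * here-leaves + 3 * ∑ vertices (λ c → χ (onward? a b c) * weight c b)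
          ≡⟨ cong (3 * here-leaves +_) (trans (sym (*-distribˡ-∑ vertices 3 _)) (∑-cong vertices λ c →
               solve 2 (λ x w → con 3 :* (x :* w) := x :* (con 3 :* w)) refl (χ (onward? a b c)) (weight c b))) ⟩
        3 * here-leaves + ∑ vertices (λ c → χ (onward? a b c) * (3 * weight c b))
          ≤⟨ +-monoʳ-≤ (3 * here-leaves) (∑-mono vertices small) ⟩
        3 * here-leaves + ∑ vertices (λ c → n * χ (onward? a b c))
          ≡⟨ cong (3 * here-leaves +_) (*-distribˡ-∑ vertices n _) ⟩
        3 * here-leaves + n * onward ∎
        where open +-*-Solver

      light : degree b ≡ 1 ⊎ degree b ≡ 3 → 3 * weight b a ≤ 2 * n
      -- At a tree leaf nothing lies onward, so at most the single element placed at `b` counts, and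
      -- 3 ≤ 2n because n ≥ 2.
      light (inj₁ d≡1) = begin
        3 * weight b a                ≤⟨ bound ⟩
        3 * here-leaves + n * onward  ≤⟨ +-mono-≤ (*-monoʳ-≤ 3 (leaf-simple b)) (*-monoʳ-≤ n (s≤s⁻¹ (≤-trans (onward-count a~b) (≤-reflexive d≡1)))) ⟩
        3 + n * 0                     ≡⟨ cong (3 +_) (*-zeroʳ n) ⟩
        3                             ≤⟨ n≤1+n 3 ⟩
        4                             ≤⟨ *-monoʳ-≤ 2 2≤length ⟩
        2 * n                         ∎
      -- At an inner node no element is placed at `b`, and each of the at most two onward branches
      -- carries less than a third.
      light (inj₂ d≡3) = begin
        3 * weight b a                ≤⟨ bound ⟩
        3 * here-leaves + n * onward  ≤⟨ +-mono-≤ (≤-reflexive (cong (3 *_) no-leaf)) (*-monoʳ-≤ n (s≤s⁻¹ (≤-trans (onward-count a~b) (≤-reflexive d≡3)))) ⟩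
        n * 2                         ≡⟨ *-comm n 2 ⟩
        2 * n                         ∎
        where
        no-leaf : here-leaves ≡ 0
        no-leaf = trans (∑-cong vs (λ v → χ-false (leaf v ≟ b)
          λ { refl → contradiction (trans (sym (leaf-degree v)) d≡3) λ () })) (∑-zero vs)

    Balanced : Set
    Balanced = ∃₂ λ a b → a ~ b × n ≤ 3 * weight a b × 3 * weight a b ≤ 2 * n

    -- `N` bounds `size b a` and serves as fuel; since the size drops strictly at each move, it
    -- cannot run out. The edge is reported from the side of `c`, whose weight lies between one and
    -- two thirds.
    descend : ∀ N {a b} → a ~ b → size b a ≤ N → 2 * n < 3 * weight b a → Balanced
    descend N {a} {b} a~b size≤N heavy with heavy-onward a~b heavy
    ... | c , (b~c , c≢a) , n≤ with 3 * weight c b ≤? 2 * n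
    ...   | yes ≤2n = c , b , ~-sym b~c , n≤ , ≤2n
    descend zero    a~b size≤N heavy | c , (b~c , c≢a) , n≤ | no ¬≤2n =
      contradiction (≤-trans (size-< b~c c≢a) size≤N) λ ()
    descend (suc N) a~b size≤N heavy | c , (b~c , c≢a) , n≤ | no ¬≤2n =
      descend N b~c (s≤s⁻¹ (≤-trans (size-< b~c c≢a) size≤N)) (≰⇒> ¬≤2n)

    weights : ∀ {a b} → a ~ b → n ≤ weight a b + weight b a
    weights {a} {b} a~b = begin
      n                               ≡⟨ *-identityʳ n ⟨
      n * 1                           ≡⟨ ∑-const vs 1 ⟨
      ∑ vs (λ _ → 1)                  ≤⟨ ∑-mono vs (λ v → covered v (branch-cover connected a~b (leaf v))) ⟩
      ∑ vs (λ v → χ (branch? a b (leaf v)) + χ (branch? b a (leaf v))) ≡⟨ ∑-distrib-+ vs _ _ ⟩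
      weight a b + weight b a         ∎
      where
      open ≤-Reasoning
      covered : ∀ v → Branch a b (leaf v) ⊎ Branch b a (leaf v) →
                1 ≤ χ (branch? a b (leaf v)) + χ (branch? b a (leaf v))
      covered v (inj₁ s) = m≤n⇒m≤n+o _ (≤-reflexive (sym (χ-true (branch? a b (leaf v)) s)))
      covered v (inj₂ s) = m≤n⇒m≤o+n _ (≤-reflexive (sym (χ-true (branch? b a (leaf v)) s)))

    balanced-edge : Balanced
    balanced-edge with some-edge connected 2≤order
    ... | a , b , a~b with 3 * weight b a ≤? 2 * n
    ...   | no heavy = descend _ a~b ≤-refl (≰⇒> heavy)
    ...   | yes light with 3 * weight a b ≤? 2 * n
    ...     | no heavy = descend _ (~-sym a~b) ≤-refl (≰⇒> heavy)
    -- The two sides together carry at least `n`, and the side of `b` at most two thirds of it, so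
    -- the side of `a` carries at least one third.
    ...     | yes light′ = a , b , a~b , +-cancelʳ-≤ (2 * n) n _ (begin
      n + 2 * n                         ≤⟨ *-monoʳ-≤ 3 (weights a~b) ⟩
      3 * (weight a b + weight b a)     ≡⟨ *-distribˡ-+ 3 (weight a b) _ ⟩
      3 * weight a b + 3 * weight b a   ≤⟨ +-monoʳ-≤ (3 * weight a b) light ⟩
      3 * weight a b + 2 * n            ∎) , light′
      where open ≤-Reasoning

-- Separated pairs and mixed lines in the grid.

∑χ+∑χ¬ : ∀ {P : Pred A 0ℓ} (P? : Decidable P) xs → ∑ xs (χ ∘ P?) + ∑ xs (χ ∘ ¬? ∘ P?) ≡ length xs
∑χ+∑χ¬ P? xs = begin
  ∑ xs (χ ∘ P?) + ∑ xs (χ ∘ ¬? ∘ P?)          ≡⟨ ∑-distrib-+ xs _ _ ⟨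
  ∑ xs (λ x → χ (P? x) + χ (¬? (P? x)))       ≡⟨ ∑-cong xs (χ-¬ ∘ P?) ⟩
  ∑ xs (λ _ → 1)                              ≡⟨ ∑-const xs 1 ⟩
  length xs * 1                               ≡⟨ *-identityʳ _ ⟩
  length xs                                   ∎
  where open ≡-Reasoning

-- The two sides differ by the square of `a - b`; the larger number is written as the smaller plus
-- `d` to stay in the naturals.
4ab≤[a+b]² : ∀ a b → 4 * (a * b) ≤ (a + b) * (a + b)
4ab≤[a+b]² a b with ≤-total a b
... | inj₁ a≤b = subst (λ b → 4 * (a * b) ≤ (a + b) * (a + b)) (m+[n∸m]≡n a≤b) (begin
  4 * (a * (a + d))                  ≤⟨ m≤m+n _ (d * d) ⟩
  4 * (a * (a + d)) + d * d          ≡⟨ solve 2 (λ a d → con 4 :* (a :* (a :+ d)) :+ d :* d := (a :+ (a :+ d)) :* (a :+ (a :+ d))) refl a d ⟩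
  (a + (a + d)) * (a + (a + d))      ∎)
  where
  open ≤-Reasoning
  open +-*-Solver
  d = b ∸ a
... | inj₂ b≤a = subst (λ a → 4 * (a * b) ≤ (a + b) * (a + b)) (m+[n∸m]≡n b≤a) (begin
  4 * ((b + d) * b)                  ≤⟨ m≤m+n _ (d * d) ⟩
  4 * ((b + d) * b) + d * d          ≡⟨ solve 2 (λ b d → con 4 :* ((b :+ d) :* b) :+ d :* d := (b :+ d :+ b) :* (b :+ d :+ b)) refl b d ⟩
  (b + d + b) * (b + d + b)          ∎)
  where
  open ≤-Reasoning
  open +-*-Solver
  d = a ∸ b

points : ∀ m k → List (Vec (Fin m) k)
points m = vecs (allFin m)

length-allFin : ∀ m → length (allFin m) ≡ m
length-allFin m = length-tabulate (λ i → i)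

∑-points-const : ∀ m k c → ∑ (points m k) (λ _ → c) ≡ m ^ k * c
∑-points-const m k c = trans (∑-vecs-const (allFin m) k c) (cong (λ l → l ^ k * c) (length-allFin m))

length-points : ∀ m k → length (points m k) ≡ m ^ k
length-points m k = begin
  length (points m k)          ≡⟨ *-identityʳ _ ⟨
  length (points m k) * 1      ≡⟨ ∑-const (points m k) 1 ⟨
  ∑ (points m k) (λ _ → 1)     ≡⟨ ∑-points-const m k 1 ⟩
  m ^ k * 1                    ≡⟨ *-identityʳ _ ⟩
  m ^ k                        ∎
  where open ≡-Reasoning

module _ {m k} {X : Pred (Vec (Fin m) (suc k)) 0ℓ} (X? : Decidable X) where

  Mixed : Fin (suc k) → Vec (Fin m) k → Set
  Mixed i v = (∃ λ a → X (insertAt v i a)) × (∃ λ b → ¬ X (insertAt v i b))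

  mixed? : ∀ i v → Dec (Mixed i v)
  mixed? i v = Fin.any? (λ a → X? (insertAt v i a)) ×-dec Fin.any? (λ b → ¬? (X? (insertAt v i b)))

  mixedLines : Fin (suc k) → ℕ
  mixedLines i = ∑ (points m k) (λ v → χ (mixed? i v))

pairs : ∀ {m k} {X : Pred (Vec (Fin m) k) 0ℓ} → Decidable X → ℕ
pairs {m} {k} X? = ∑ (points m k) (χ ∘ X?) * ∑ (points m k) (χ ∘ ¬? ∘ X?)

-- On a mixed line the two counts add up to `m`, so their product is at most a quarter of `m * m`;
-- on any other line the product vanishes.
line-pairs : ∀ {m} {P : Pred (Fin m) 0ℓ} (P? : Decidable P) (some? : Dec (∃ P × ∃ (∁ P))) →
  4 * (∑ (allFin m) (χ ∘ P?) * ∑ (allFin m) (χ ∘ ¬? ∘ P?)) ≤ m * m * χ some?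
line-pairs {m} P? (yes _) = begin
  4 * (∑ (allFin m) (χ ∘ P?) * ∑ (allFin m) (χ ∘ ¬? ∘ P?))  ≤⟨ 4ab≤[a+b]² (∑ (allFin m) (χ ∘ P?)) _ ⟩
  _                                                         ≡⟨ cong (λ s → s * s) (trans (∑χ+∑χ¬ P? (allFin m)) (length-allFin m)) ⟩
  m * m                                                     ≡⟨ *-identityʳ _ ⟨
  m * m * 1                                                 ∎
  where open ≤-Reasoning
line-pairs {m} {P} P? (no pure) = ≤-trans (≤-reflexive (cong (4 *_) (trans (∑-*-∑ (allFin m) (allFin m) _ _)
  (trans (∑-cong (allFin m) (λ a → trans (∑-cong (allFin m) (zeros a)) (∑-zero (allFin m)))) (∑-zero (allFin m)))))) z≤n
  where
  zeros : ∀ a b → χ (P? a) * χ (¬? (P? b)) ≡ 0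
  zeros a b = trans (sym (χ-× (P? a) (¬? (P? b)))) (χ-false (P? a ×-dec ¬? (P? b)) λ (pa , ¬pb) → pure ((a , pa) , (b , ¬pb)))

-- Given `P` and not `R`, either value of `Q` makes one of the two intermediate pairs separated.
χ-triangle : ∀ {P Q R : Set} (P? : Dec P) (Q? : Dec Q) (R? : Dec R) →
             χ P? * χ (¬? R?) ≤ χ P? * χ (¬? Q?) + χ Q? * χ (¬? R?)
χ-triangle (no _)  _       _       = z≤n
χ-triangle (yes _) (yes _) R?      = ≤-refl
χ-triangle (yes _) (no _)  (yes _) = z≤n
χ-triangle (yes _) (no _)  (no _)  = ≤-refl

-- A pair (a ∷ v) ∈ X, (b ∷ w) ∉ X is separated either from (b ∷ v) along the first
-- coordinate or, with first coordinate b fixed, from (b ∷ v) inside the slice at b.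
pairs-slice : ∀ {m k} {X : Pred (Vec (Fin m) (suc k)) 0ℓ} (X? : Decidable X) →
  4 * pairs X? ≤ m ^ suc (suc k) * mixedLines X? zero + m * ∑ (allFin m) (λ b → 4 * pairs (X? ∘ (b ∷_)))
pairs-slice {m} {k} X? = begin
  4 * pairs X?
    ≡⟨ cong (4 *_) (cong₂ _*_ (∑-vecs-suc F k _) (∑-vecs-suc F k _)) ⟩
  4 * (∑ F (λ a → ∑ V (λ v → u a v)) * ∑ F (λ b → ∑ V (λ w → ū b w)))
    ≡⟨ cong (4 *_) (trans (∑-*-∑ F F _ _) (∑-cong F λ a → ∑-cong F λ b → ∑-*-∑ V V _ _)) ⟩
  4 * ∑ F (λ a → ∑ F (λ b → ∑ V (λ v → ∑ V (λ w → u a v * ū b w))))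
    ≤⟨ *-monoʳ-≤ 4 (∑-mono F λ a → ∑-mono F λ b → ∑-mono V λ v → ∑-mono V λ w →
         χ-triangle (X? (a ∷ v)) (X? (b ∷ v)) (X? (b ∷ w))) ⟩
  4 * ∑ F (λ a → ∑ F (λ b → ∑ V (λ v → ∑ V (λ w → u a v * ū b v + u b v * ū b w))))
    ≡⟨ cong (4 *_) (trans (∑-cong F λ a → trans (∑-cong F λ b → trans (∑-cong V λ v → ∑-distrib-+ V _ _)
         (∑-distrib-+ V _ _)) (∑-distrib-+ F _ _)) (∑-distrib-+ F _ _)) ⟩
  4 * (∑ F (λ a → ∑ F (λ b → ∑ V (λ v → ∑ V (λ w → u a v * ū b v)))) +
       ∑ F (λ a → ∑ F (λ b → ∑ V (λ v → ∑ V (λ w → u b v * ū b w)))))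
    ≡⟨ cong (4 *_) (cong₂ _+_ along inside) ⟩
  4 * (m ^ k * ∑ V (λ v → ∑ F (λ a → u a v) * ∑ F (λ b → ū b v)) + m * ∑ F (λ b → pairs (X? ∘ (b ∷_))))
    ≡⟨ solve 4 (λ p s m t → con 4 :* (p :* s :+ m :* t) := p :* (con 4 :* s) :+ m :* (con 4 :* t)) refl
         (m ^ k) (∑ V (λ v → ∑ F (λ a → u a v) * ∑ F (λ b → ū b v))) m (∑ F (λ b → pairs (X? ∘ (b ∷_)))) ⟩
  m ^ k * (4 * ∑ V (λ v → ∑ F (λ a → u a v) * ∑ F (λ b → ū b v))) + m * (4 * ∑ F (λ b → pairs (X? ∘ (b ∷_))))
    ≡⟨ cong₂ (λ x y → m ^ k * x + m * y) (*-distribˡ-∑ V 4 _) (*-distribˡ-∑ F 4 _) ⟨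
  m ^ k * ∑ V (λ v → 4 * (∑ F (λ a → u a v) * ∑ F (λ b → ū b v))) + m * ∑ F (λ b → 4 * pairs (X? ∘ (b ∷_)))
    ≤⟨ +-monoˡ-≤ _ (*-monoʳ-≤ (m ^ k) (∑-mono V λ v → line-pairs (λ a → X? (a ∷ v)) (mixed? X? zero v))) ⟩
  m ^ k * ∑ V (λ v → m * m * χ (mixed? X? zero v)) + m * ∑ F (λ b → 4 * pairs (X? ∘ (b ∷_)))
    ≡⟨ cong (_+ m * ∑ F (λ b → 4 * pairs (X? ∘ (b ∷_)))) (trans (cong (m ^ k *_) (*-distribˡ-∑ V (m * m) _))
         (solve 3 (λ p m s → p :* (m :* m :* s) := m :* (m :* p) :* s) refl (m ^ k) m (mixedLines X? zero))) ⟩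
  m ^ suc (suc k) * mixedLines X? zero + m * ∑ F (λ b → 4 * pairs (X? ∘ (b ∷_))) ∎
  where
  open ≤-Reasoning
  open +-*-Solver
  F = allFin m
  V = points m k
  u : Fin m → Vec (Fin m) k → ℕ
  u a v = χ (X? (a ∷ v))
  ū : Fin m → Vec (Fin m) k → ℕ
  ū a v = χ (¬? (X? (a ∷ v)))

  -- The point `w` does not occur in the summand and contributes the factor `m ^ k`; what remains is
  -- a sum over the lines in the first direction.
  along : ∑ F (λ a → ∑ F (λ b → ∑ V (λ v → ∑ V (λ w → u a v * ū b v)))) ≡
          m ^ k * ∑ V (λ v → ∑ F (λ a → u a v) * ∑ F (λ b → ū b v))
  along = begin-equality
    ∑ F (λ a → ∑ F (λ b → ∑ V (λ v → ∑ V (λ w → u a v * ū b v))))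
      ≡⟨ (∑-cong F λ a → ∑-cong F λ b → trans (∑-cong V λ v → ∑-points-const m k _) (*-distribˡ-∑ V (m ^ k) _)) ⟩
    ∑ F (λ a → ∑ F (λ b → m ^ k * ∑ V (λ v → u a v * ū b v)))
      ≡⟨ trans (∑-cong F λ a → *-distribˡ-∑ F (m ^ k) _) (*-distribˡ-∑ F (m ^ k) _) ⟩
    m ^ k * ∑ F (λ a → ∑ F (λ b → ∑ V (λ v → u a v * ū b v)))
      ≡⟨ cong (m ^ k *_) (trans (∑-cong F λ a → ∑-swap F V _) (∑-swap F V _)) ⟩
    m ^ k * ∑ V (λ v → ∑ F (λ a → ∑ F (λ b → u a v * ū b v)))
      ≡⟨ cong (m ^ k *_) (∑-cong V λ v → ∑-*-∑ F F _ _) ⟨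
    m ^ k * ∑ V (λ v → ∑ F (λ a → u a v) * ∑ F (λ b → ū b v)) ∎

  -- Here `a` is free and contributes the factor `m`.
  inside : ∑ F (λ a → ∑ F (λ b → ∑ V (λ v → ∑ V (λ w → u b v * ū b w)))) ≡ m * ∑ F (λ b → pairs (X? ∘ (b ∷_)))
  inside = trans (∑-const F _) (cong₂ _*_ (length-allFin m) (∑-cong F λ b → sym (∑-*-∑ V V _ _)))

-- A discrete Poincaré inequality: the sizes of a set and its complement are controlled by the
-- boundary, measured in mixed lines. The induction slices the grid along its first coordinate.
poincaré : ∀ k {m} {X : Pred (Vec (Fin m) (suc k)) 0ℓ} (X? : Decidable X) →
  4 * pairs X? ≤ m ^ suc (suc k) * ∑ (allFin (suc k)) (mixedLines X?)
poincaré zero {m} X? = begin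
  4 * pairs X?
    ≤⟨ pairs-slice X? ⟩
  m ^ 2 * mixedLines X? zero + m * ∑ (allFin m) (λ b → 4 * pairs (X? ∘ (b ∷_)))
    -- In dimension one a slice is a single point, so it contains no separated pair.
    ≡⟨ cong (λ s → m ^ 2 * mixedLines X? zero + m * s)
         (trans (∑-cong (allFin m) λ b → cong (4 *_) (no-pairs (X? (b ∷ [])))) (∑-zero (allFin m))) ⟩
  m ^ 2 * mixedLines X? zero + m * 0
    ≡⟨ cong₂ _+_ (cong (m ^ 2 *_) (sym (+-identityʳ _))) (*-zeroʳ m) ⟩
  m ^ 2 * (mixedLines X? zero + 0) + 0
    ≡⟨ +-identityʳ _ ⟩
  m ^ 2 * (mixedLines X? zero + 0) ∎
  where
  open ≤-Reasoning
  no-pairs : ∀ {P : Set} (P? : Dec P) → (χ P? + 0) * (χ (¬? P?) + 0) ≡ 0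
  no-pairs (yes _) = refl
  no-pairs (no _)  = refl
poincaré (suc k) {m} X? = begin
  4 * pairs X?
    ≤⟨ pairs-slice X? ⟩
  M * mixedLines X? zero + m * ∑ F (λ b → 4 * pairs (X? ∘ (b ∷_)))
    ≤⟨ +-monoʳ-≤ (M * mixedLines X? zero) (*-monoʳ-≤ m (∑-mono F λ b → poincaré k (X? ∘ (b ∷_)))) ⟩
  M * mixedLines X? zero + m * ∑ F (λ b → m ^ suc (suc k) * ∑ (allFin (suc k)) (mixedLines (X? ∘ (b ∷_))))
    ≡⟨ cong (λ s → M * mixedLines X? zero + m * s) (*-distribˡ-∑ F (m ^ suc (suc k)) _) ⟩
  M * mixedLines X? zero + m * (m ^ suc (suc k) * ∑ F (λ b → ∑ (allFin (suc k)) (mixedLines (X? ∘ (b ∷_)))))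
    ≡⟨ cong (M * mixedLines X? zero +_) (sym (*-assoc m _ _)) ⟩
  M * mixedLines X? zero + M * ∑ F (λ b → ∑ (allFin (suc k)) (mixedLines (X? ∘ (b ∷_))))
    -- A line in direction `suc i` lies in the slice at its first coordinate `b` and is a line in
    -- direction `i` there, so the slices together count each such line once.
    ≡⟨ cong (λ s → M * mixedLines X? zero + M * s) (trans (∑-swap F (allFin (suc k)) _)
         (∑-cong (allFin (suc k)) λ i → sym (∑-vecs-suc F k (λ v → χ (mixed? X? (suc i) v))))) ⟩
  M * mixedLines X? zero + M * ∑ (allFin (suc k)) (mixedLines X? ∘ suc)
    ≡⟨ *-distribˡ-+ M (mixedLines X? zero) _ ⟨
  M * (mixedLines X? zero + ∑ (allFin (suc k)) (mixedLines X? ∘ suc))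
    ≡⟨ cong (M *_) (∑-allFin-suc (suc k) (mixedLines X?)) ⟨
  M * ∑ (allFin (suc (suc k))) (mixedLines X?) ∎
  where
  open ≤-Reasoning
  F = allFin m
  M = m ^ suc (suc (suc k))

-- Independence over 𝔽₂ and induced matchings.

sum-single : ∀ {s} (f : Fin s → Bool) l → (∀ i → i ≢ l → f i ≡ false) → 𝔽₂.sum f ≡ f l
sum-single {suc s} f l zeros = begin
  𝔽₂.sum f                                        ≡⟨ 𝔽₂.sum-remove {i = l} f ⟩
  f l xor 𝔽₂.sum (λ i → f (punchIn l i))          ≡⟨ cong (f l xor_) (trans (𝔽₂.sum-cong-≗ λ i → zeros (punchIn l i) (Fin.punchInᵢ≢i l i)) (𝔽₂.sum-replicate-zero s)) ⟩
  f l xor false                                   ≡⟨ Bool.xor-identityʳ (f l) ⟩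
  f l                                             ∎
  where open ≡-Reasoning

-- Reading the relation in the column matched to row `i` leaves only the term `c i`.
inducedMatching⇒independent : ∀ {s} {J : Set} (M : Fin s → J → Bool) (col : Fin s → J) →
  (∀ i → M i (col i) ≡ true) → (∀ i l → i ≢ l → M i (col l) ≡ false) → Independent M
inducedMatching⇒independent M col diagonal off c relation i = begin
  c i                                     ≡⟨ Bool.∧-identityʳ (c i) ⟨
  c i ∧ true                              ≡⟨ cong (c i ∧_) (diagonal i) ⟨
  c i ∧ M i (col i)                       ≡⟨ sum-single _ i (λ l l≢i → trans (cong (c l ∧_) (off l i l≢i)) (Bool.∧-zeroʳ (c l))) ⟨
  𝔽₂.sum (λ l → c l ∧ M l (col i))        ≡⟨ relation (col i) ⟩
  false                                   ∎
  where open ≡-Reasoning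

-- Two equal rows with different indices would add up to zero over 𝔽₂. This bounds the size of an
-- independent family by the number of vertices.
independent⇒distinct : ∀ {s} {J : Set} (M : Fin s → J → Bool) → Independent M →
                       ∀ {i l} → M i ≗ M l → i ≡ l
independent⇒distinct {s} M independent {i} {l} same with i Fin.≟ l
... | yes i≡l = i≡l
... | no i≢l  = contradiction (trans (sym ci≡true) (independent c relation i)) λ ()
  where
  open ≡-Reasoning
  δ : Fin s → Fin s → Bool
  δ i t = does (t Fin.≟ i)
  δ-diagonal : ∀ i → δ i i ≡ true
  δ-diagonal i = dec-true (i Fin.≟ i) refl
  c : Fin s → Bool
  c t = δ i t xor δ l t
  ci≡true : c i ≡ true
  ci≡true = cong₂ _xor_ (δ-diagonal i) (dec-false (i Fin.≟ l) i≢l)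
  pick : ∀ i j → 𝔽₂.sum (λ t → δ i t ∧ M t j) ≡ M i j
  pick i j = trans (sum-single _ i (λ t t≢i → cong (_∧ M t j) (dec-false (t Fin.≟ i) t≢i)))
                   (cong (_∧ M i j) (δ-diagonal i))
  relation : ∀ j → 𝔽₂.sum (λ t → c t ∧ M t j) ≡ false
  relation j = begin
    𝔽₂.sum (λ t → c t ∧ M t j)
      ≡⟨ 𝔽₂.sum-cong-≗ (λ t → Bool.∧-distribʳ-xor (M t j) (δ i t) (δ l t)) ⟩
    𝔽₂.sum (λ t → (δ i t ∧ M t j) xor (δ l t ∧ M t j))
      ≡⟨ 𝔽₂.∑-distrib-+ (λ t → δ i t ∧ M t j) _ ⟩
    𝔽₂.sum (λ t → δ i t ∧ M t j) xor 𝔽₂.sum (λ t → δ l t ∧ M t j)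
      ≡⟨ cong₂ _xor_ (pick i j) (trans (pick l j) (sym (same j))) ⟩
    M i j xor M i j
      ≡⟨ Bool.xor-same (M i j) ⟩
    false ∎

-- Existence under a double negation.

-- The search runs downwards from the bound `N`, with excluded middle for each candidate.
¬¬-maximum : ∀ N {P : ℕ → Set} → P 0 → (∀ s → P s → s ≤ N) → ¬ ¬ ∃ (IsMaximum P)
¬¬-maximum zero    p₀ bound none = none (0 , p₀ , bound)
¬¬-maximum (suc N) {P} p₀ bound none = ¬¬-excluded-middle λ
  { (yes p) → none (suc N , p , bound)
  ; (no ¬p) → ¬¬-maximum N p₀ (λ s ps → s≤s⁻¹ (≤∧≢⇒< (bound s ps) λ { refl → ¬p ps })) none }

-- Double-negation shift, valid here because the vertices are finitely enumerated.
¬¬-∀ : ∀ (G : Graph) {P : Graph.Vertex G → Set} → (∀ v → ¬ ¬ P v) → ¬ ¬ (∀ v → P v)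
¬¬-∀ G {P} ¬¬p none = Fin.sequence (RawMonad.rawApplicative ¬¬-Monad) (¬¬p ∘ Inverse.from enum)
  λ p → none λ v → subst P (Inverse.strictlyInverseʳ enum v) (p (Inverse.to enum v))
  where open Graph G

¬¬-branch? : ∀ T → ¬ ¬ (∀ a b → Decidable (Branch T a b))
¬¬-branch? T = ¬¬-∀ T λ a → ¬¬-∀ T λ b → ¬¬-∀ T λ t → ¬¬-excluded-middle

-- The empty family attains 0, and independent rows come from distinct vertices, so `order` is an
-- upper bound.
¬¬-cutRank : ∀ G X → ¬ ¬ ∃ (IsCutRank G X)
¬¬-cutRank G X = ¬¬-maximum order ((λ ()) , λ _ _ ()) λ s (rows , independent) →
  Fin.injective⇒≤ {f = Inverse.to enum ∘ proj₁ ∘ rows} λ {i} {l} eq →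
    independent⇒distinct _ independent λ y →
      cong (λ x → does (x ~? proj₁ y)) (Injection.injective (↔⇒↣ enum) eq)
  where open Graph G

-- Lines of the Hamming graph.

lookup-injective : ∀ {xs : List A} → Unique xs → ∀ {i j} → lookup xs i ≡ lookup xs j → i ≡ j
lookup-injective (_ ∷ _)    {zero}  {zero}  _  = refl
lookup-injective (x∉ ∷ _)   {zero}  {suc j} eq = contradiction eq (All.lookup x∉ (∈-lookup j))
lookup-injective (x∉ ∷ _)   {suc i} {zero}  eq = contradiction (sym eq) (All.lookup x∉ (∈-lookup i))
lookup-injective (_ ∷ xs!)  {suc i} {suc j} eq = cong suc (lookup-injective xs! eq)

module _ {k m : ℕ} where
  open Graph (hamming (suc k) m)

  line-adjacent : ∀ v (i : Fin (suc k)) {a b} → a ≢ b → insertAt v i a ~ insertAt v i b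
  line-adjacent v i {a} {b} a≢b = i ,
    subst₂ _≢_ (sym (insertAt-lookup v i a)) (sym (insertAt-lookup v i b)) a≢b , same
    where
    same : ∀ j → j ≢ i → Vec.lookup (insertAt v i a) j ≡ Vec.lookup (insertAt v i b) j
    same j j≢i = subst (λ j → Vec.lookup (insertAt v i a) j ≡ Vec.lookup (insertAt v i b) j)
      (Fin.punchIn-punchOut (j≢i ∘ sym))
      (trans (insertAt-punchIn v i a _) (sym (insertAt-punchIn v i b _)))

  -- The endpoints already differ in coordinate `i`, which is therefore the only one that the edge
  -- changes; all remaining coordinates agree.
  adjacent⇒same-line : ∀ {v w} (i : Fin (suc k)) {a b} → a ≢ b → insertAt v i a ~ insertAt w i b → v ≡ w
  adjacent⇒same-line {v} {w} i {a} {b} a≢b (j , _ , same) with i Fin.≟ j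
  ... | no i≢j = contradiction
    (trans (sym (insertAt-lookup v i a)) (trans (same i i≢j) (insertAt-lookup w i b))) a≢b
  ... | yes refl = trans (sym (tabulate∘lookup v)) (trans (tabulate-cong λ l →
    trans (sym (insertAt-punchIn v i a l)) (trans (same (punchIn i l) (Fin.punchInᵢ≢i i l)) (insertAt-punchIn w i b l)))
    (tabulate∘lookup w))

-- Random subsets separating two elements.

-- Subsets of `Fin m` as characteristic vectors; sums over this list stand in for expectations.
subsets : ∀ m → List (Vec Bool m)
subsets = vecs (true ∷ false ∷ [])

member? : ∀ {m} (S : Vec Bool m) a c → Dec (Vec.lookup S a ≡ c)
member? S a c = Vec.lookup S a Bool.≟ c

∑-subsets-suc : ∀ m (f : Vec Bool (suc m) → ℕ) →
  ∑ (subsets (suc m)) f ≡ ∑ (subsets m) (f ∘ (true ∷_)) + ∑ (subsets m) (f ∘ (false ∷_))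
∑-subsets-suc m f = trans (∑-vecs-suc (true ∷ false ∷ []) m f)
  (cong (∑ (subsets m) (f ∘ (true ∷_)) +_) (+-identityʳ _))

-- Each coordinate of a random subset is a fair bit; the probability is multiplied out to stay in
-- the naturals.
half : ∀ {m} (a : Fin m) c → 2 * ∑ (subsets m) (λ S → χ (member? S a c)) ≡ 2 ^ m
half {suc m} zero true = begin
  2 * ∑ (subsets (suc m)) (λ S → χ (member? S zero true))        ≡⟨ cong (2 *_) (∑-subsets-suc m _) ⟩
  2 * (∑ (subsets m) (λ _ → 1) + ∑ (subsets m) (λ _ → 0))         ≡⟨ cong (2 *_) (cong₂ _+_ (∑-vecs-const _ m 1) (∑-zero (subsets m))) ⟩
  2 * (2 ^ m * 1 + 0)                                             ≡⟨ cong (2 *_) (trans (+-identityʳ (2 ^ m * 1)) (*-identityʳ (2 ^ m))) ⟩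
  2 ^ suc m                                                       ∎
  where open ≡-Reasoning
half {suc m} zero false = begin
  2 * ∑ (subsets (suc m)) (λ S → χ (member? S zero false))       ≡⟨ cong (2 *_) (∑-subsets-suc m _) ⟩
  2 * (∑ (subsets m) (λ _ → 0) + ∑ (subsets m) (λ _ → 1))         ≡⟨ cong (2 *_) (cong₂ _+_ (∑-zero (subsets m)) (∑-vecs-const _ m 1)) ⟩
  2 * (2 ^ m * 1)                                                 ≡⟨ cong (2 *_) (*-identityʳ (2 ^ m)) ⟩
  2 ^ suc m                                                       ∎
  where open ≡-Reasoning
half {suc m} (suc a) c = begin
  2 * ∑ (subsets (suc m)) (λ S → χ (member? S (suc a) c))         ≡⟨ cong (2 *_) (∑-subsets-suc m _) ⟩
  2 * (h + h)                                                     ≡⟨ *-distribˡ-+ 2 h h ⟩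
  2 * h + 2 * h                                                   ≡⟨ cong₂ _+_ (half a c) (trans (half a c) (sym (+-identityʳ _))) ⟩
  2 ^ suc m                                                       ∎
  where
  open ≡-Reasoning
  h = ∑ (subsets m) (λ S → χ (member? S a c))

separates? : ∀ {m} (a b : Fin m) S → Dec (Vec.lookup S a ≡ true × Vec.lookup S b ≡ false)
separates? a b S = member? S a true ×-dec member? S b false

-- Distinct coordinates are independent fair bits. The recursion drops leading coordinates until `a`
-- or `b` comes first; fixing that bit leaves the count of `half`.
quarter : ∀ {m} {a b : Fin m} → a ≢ b → 4 * ∑ (subsets m) (χ ∘ separates? a b) ≡ 2 ^ m
quarter {_}     {zero}  {zero}  a≢b = contradiction refl a≢b
quarter {suc m} {zero}  {suc b} a≢b = begin
  4 * ∑ (subsets (suc m)) (χ ∘ separates? zero (suc b))  ≡⟨ cong (4 *_) (∑-subsets-suc m _) ⟩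
  4 * (h + ∑ (subsets m) (λ _ → 0))                      ≡⟨ cong (λ z → 4 * (h + z)) (∑-zero (subsets m)) ⟩
  4 * (h + 0)                                            ≡⟨ solve 1 (λ h → con 4 :* (h :+ con 0) := con 2 :* (con 2 :* h)) refl h ⟩
  2 * (2 * h)                                            ≡⟨ cong (2 *_) (half b false) ⟩
  2 ^ suc m                                              ∎
  where
  open ≡-Reasoning
  open +-*-Solver
  h = ∑ (subsets m) (λ S → χ (member? S b false))
quarter {suc m} {suc a} {zero}  a≢b = begin
  4 * ∑ (subsets (suc m)) (χ ∘ separates? (suc a) zero)  ≡⟨ cong (4 *_) (∑-subsets-suc m _) ⟩
  4 * (∑ (subsets m) (λ S → χ (member? S a true ×-dec (true Bool.≟ false))) +
       ∑ (subsets m) (λ S → χ (member? S a true ×-dec (false Bool.≟ false))))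
    ≡⟨ cong (4 *_) (cong₂ _+_
         (trans (∑-cong (subsets m) λ S → trans (χ-× (member? S a true) (true Bool.≟ false)) (*-zeroʳ (χ (member? S a true))))
                (∑-zero (subsets m)))
         (∑-cong (subsets m) λ S → trans (χ-× (member? S a true) (false Bool.≟ false)) (*-identityʳ _))) ⟩
  4 * (0 + h)                                            ≡⟨ solve 1 (λ h → con 4 :* h := con 2 :* (con 2 :* h)) refl h ⟩
  2 * (2 * h)                                            ≡⟨ cong (2 *_) (half a true) ⟩
  2 ^ suc m                                              ∎
  where
  open ≡-Reasoning
  open +-*-Solver
  h = ∑ (subsets m) (λ S → χ (member? S a true))
quarter {suc m} {suc a} {suc b} a≢b = begin
  4 * ∑ (subsets (suc m)) (χ ∘ separates? (suc a) (suc b)) ≡⟨ cong (4 *_) (∑-subsets-suc m _) ⟩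
  4 * (h + h)                                              ≡⟨ *-distribˡ-+ 4 h h ⟩
  4 * h + 4 * h                                            ≡⟨ cong₂ _+_ h≡ (trans h≡ (sym (+-identityʳ _))) ⟩
  2 ^ suc m                                                ∎
  where
  open ≡-Reasoning
  h = ∑ (subsets m) (χ ∘ separates? a b)
  h≡ = quarter {a = a} {b} (a≢b ∘ cong suc)

-- Mixed lines in one direction against the cut-rank.

module _ {k m : ℕ} {X : Pred (Vec (Fin m) (suc k)) 0ℓ} (X? : Decidable X) (i : Fin (suc k)) where
  open Graph (hamming (suc k) m) using (_~_; _~?_)

  -- The two points may vary with `S` instead of being fixed for each line, which can only increase
  -- the number of split lines.
  Split : Vec Bool m → Vec (Fin m) k → Set
  Split S v = ∃₂ λ a b → (Vec.lookup S a ≡ true × Vec.lookup S b ≡ false) ×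
                         X (insertAt v i a) × ¬ X (insertAt v i b)

  split? : ∀ S → Decidable (Split S)
  split? S v = Fin.any? λ a → Fin.any? λ b →
    separates? a b S ×-dec X? (insertAt v i a) ×-dec ¬? (X? (insertAt v i b))

  -- Lines split by S contribute a point with i-th coordinate inside S and one with
  -- i-th coordinate outside S; points of distinct lines then differ in coordinate i and
  -- elsewhere, so that these edges form an induced matching across the cut.
  split-≤-rank : ∀ {r} → IsCutRank (hamming (suc k) m) X r → ∀ S →
                 ∑ (points m k) (χ ∘ split? S) ≤ r
  split-≤-rank (_ , maximal) S = subst (_≤ _) (length-filter-∑ (split? S) (points m k))
    (maximal (length L) (rows , inducedMatching⇒independent _ cols diagonal off))
    where
    L = filter (split? S) (points m k)
    L! : Unique L
    L! = Unique.filter⁺ (split? S) (vecs-unique (Unique.allFin⁺ m) k)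
    split : ∀ l → Split S (lookup L l)
    split l = proj₂ (∈-filter⁻ (split? S) {xs = points m k} (∈-lookup l))
    rows : Fin (length L) → ∃ X
    rows l with split l
    ... | a , _ , _ , x , _ = insertAt (lookup L l) i a , x
    cols : Fin (length L) → ∃ (∁ X)
    cols l with split l
    ... | _ , b , _ , _ , y = insertAt (lookup L l) i b , y
    in≢out : ∀ {a b} → Vec.lookup S a ≡ true → Vec.lookup S b ≡ false → a ≢ b
    in≢out a∈ b∉ refl = contradiction (trans (sym a∈) b∉) λ ()
    diagonal : ∀ l → does (proj₁ (rows l) ~? proj₁ (cols l)) ≡ true
    diagonal l with split l
    ... | a , b , (a∈ , b∉) , _ = dec-true (insertAt (lookup L l) i a ~? insertAt (lookup L l) i b) (line-adjacent (lookup L l) i (in≢out a∈ b∉))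
    off : ∀ l l′ → l ≢ l′ → does (proj₁ (rows l) ~? proj₁ (cols l′)) ≡ false
    off l l′ l≢l′ with split l | split l′
    ... | a , _ , (a∈ , _) , _ | _ , b , (_ , b∉) , _ = dec-false (insertAt (lookup L l) i a ~? insertAt (lookup L l′) i b) λ adj →
      l≢l′ (lookup-injective L! (adjacent⇒same-line i (in≢out a∈ b∉) adj))

  -- For one fixed pair of witnesses on a mixed line, a quarter of all subsets separates it, and
  -- each of those splits the line.
  mixed-≤-4splits : ∀ v → 2 ^ m * χ (mixed? X? i v) ≤ 4 * ∑ (subsets m) (λ S → χ (split? S v))
  mixed-≤-4splits v = *χ≤ (mixed? X? i v) λ ((a , x) , (b , y)) → begin
    2 ^ m                                               ≡⟨ quarter {a = a} {b} (λ { refl → y x }) ⟨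
    4 * ∑ (subsets m) (χ ∘ separates? a b)
      ≤⟨ *-monoʳ-≤ 4 (∑-mono (subsets m) λ S → χ-mono (separates? a b S) (split? S v) λ s → a , b , s , x , y) ⟩
    4 * ∑ (subsets m) (λ S → χ (split? S v))            ∎
    where open ≤-Reasoning

  -- Double counting of a subset with a line that it splits: every subset splits at most `r` lines,
  -- every mixed line is split by at least a quarter of the subsets.
  mixedLines-≤-4rank : ∀ {r} → IsCutRank (hamming (suc k) m) X r → mixedLines X? i ≤ 4 * r
  mixedLines-≤-4rank {r} isRank = *-cancelˡ-≤ (2 ^ m) {{m^n≢0 2 m}} (begin
    2 ^ m * mixedLines X? i
      ≡⟨ *-distribˡ-∑ (points m k) (2 ^ m) _ ⟨
    ∑ (points m k) (λ v → 2 ^ m * χ (mixed? X? i v))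
      ≤⟨ ∑-mono (points m k) mixed-≤-4splits ⟩
    ∑ (points m k) (λ v → 4 * ∑ (subsets m) (λ S → χ (split? S v)))
      ≡⟨ *-distribˡ-∑ (points m k) 4 _ ⟩
    4 * ∑ (points m k) (λ v → ∑ (subsets m) (λ S → χ (split? S v)))
      ≡⟨ cong (4 *_) (∑-swap (points m k) (subsets m) _) ⟩
    4 * ∑ (subsets m) (λ S → ∑ (points m k) (χ ∘ split? S))
      ≤⟨ *-monoʳ-≤ 4 (∑-mono (subsets m) (split-≤-rank isRank)) ⟩
    4 * ∑ (subsets m) (λ _ → r)
      ≡⟨ cong (4 *_) (∑-vecs-const _ m r) ⟩
    4 * (2 ^ m * r)
      ≡⟨ solve 2 (λ p r → con 4 :* (p :* r) := p :* (con 4 :* r)) refl (2 ^ m) r ⟩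
    2 ^ m * (4 * r) ∎)
    where
    open ≤-Reasoning
    open +-*-Solver

-- The lower bound on the rank-width.

balanced-cutRank : ∀ {k m} .{{_ : NonZero m}} {X : Pred (Vec (Fin m) (suc k)) 0ℓ} (X? : Decidable X) {r} →
  let n = m ^ suc k; p = ∑ (points m (suc k)) (χ ∘ X?) in
  n ≤ 3 * p → 3 * p ≤ 2 * n → IsCutRank (hamming (suc k) m) X r → m ^ k ≤ r * (9 * suc k)
balanced-cutRank {k} {m} X? {r} n≤3p 3p≤2n isRank =
  -- Since n = m^(k+1), the square of n is m^(k+2) times m^k, and the factor m^(k+2) of `poincaré`
  -- cancels. The 9 is the product of the factors 3 for the two sides.
  *-cancelˡ-≤ (4 * m ^ suc (suc k)) {{m*n≢0 4 _ {{_}} {{m^n≢0 m (suc (suc k))}}}} (begin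
  4 * m ^ suc (suc k) * m ^ k
    ≡⟨ solve 2 (λ m q → con 4 :* (m :* (m :* q)) :* q := con 4 :* (m :* q :* (m :* q))) refl m (m ^ k) ⟩
  4 * (n * n)
    ≤⟨ *-monoʳ-≤ 4 (*-mono-≤ n≤3p n≤3q) ⟩
  4 * (3 * p * (3 * q))
    ≡⟨ solve 2 (λ p q → con 4 :* (con 3 :* p :* (con 3 :* q)) := con 9 :* (con 4 :* (p :* q))) refl p q ⟩
  9 * (4 * (p * q))
    ≤⟨ *-monoʳ-≤ 9 (poincaré k X?) ⟩
  9 * (m ^ suc (suc k) * ∑ (allFin (suc k)) (mixedLines X?))
    ≤⟨ *-monoʳ-≤ 9 (*-monoʳ-≤ (m ^ suc (suc k)) (∑-mono (allFin (suc k)) λ i → mixedLines-≤-4rank X? i isRank)) ⟩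
  9 * (m ^ suc (suc k) * ∑ (allFin (suc k)) (λ _ → 4 * r))
    ≡⟨ cong (λ s → 9 * (m ^ suc (suc k) * s)) (trans (∑-const (allFin (suc k)) (4 * r)) (cong (_* (4 * r)) (length-allFin (suc k)))) ⟩
  9 * (m ^ suc (suc k) * (suc k * (4 * r)))
    ≡⟨ solve 3 (λ c k r → con 9 :* (c :* (k :* (con 4 :* r))) := con 4 :* c :* (r :* (con 9 :* k))) refl (m ^ suc (suc k)) (suc k) r ⟩
  4 * m ^ suc (suc k) * (r * (9 * suc k)) ∎)
  where
  open ≤-Reasoning
  open +-*-Solver
  n = m ^ suc k
  p = ∑ (points m (suc k)) (χ ∘ X?)
  q = ∑ (points m (suc k)) (χ ∘ ¬? ∘ X?)
  n≤3q : n ≤ 3 * q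
  n≤3q = +-cancelˡ-≤ (2 * n) _ _ (begin
    2 * n + n         ≡⟨ +-comm (2 * n) n ⟩
    3 * n             ≡⟨ cong (3 *_) (trans (∑χ+∑χ¬ X? (points m (suc k))) (length-points m (suc k))) ⟨
    3 * (p + q)       ≡⟨ *-distribˡ-+ 3 p q ⟩
    3 * p + 3 * q     ≤⟨ +-monoˡ-≤ (3 * q) 3p≤2n ⟩
    2 * n + 3 * q     ∎)

hamming-rankWidth : ∀ {k m r} → 2 ≤ m → IsRankWidth (hamming (suc k) m) r → m ^ k ≤ r * (9 * suc k)
hamming-rankWidth {k} {m} {r} 2≤m ((D , _ , maximal) , _) = decidable-stable (_ ≤? _) λ fails →
  ¬¬-branch? tree λ branch? →
  let (a , b , a~b , n≤3p , 3p≤2n) =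
        balanced-edge tree isTree twoNodes degree1∨3 branch? V leaf (λ v → proj₂ (Bijection.to leaves v))
          -- Distinct vertices sit at distinct leaves, so a tree vertex carries at most one of them.
          (λ t → ∑χ≤1 (λ v → leaf v T.≟ t) (vecs-unique (Unique.allFin⁺ m) (suc k)) λ { refl eq → leaf-injective (sym eq) })
          (subst (2 ≤_) (sym length-V) 2≤n)
      X? : Decidable (side a b)
      X? v = branch? a b (leaf v)
      p = ∑ V (χ ∘ X?)
  in ¬¬-cutRank (hamming (suc k) m) (side a b) λ (r′ , isRank) →
     fails (≤-trans (balanced-cutRank X?
       (subst (_≤ 3 * p) length-V n≤3p) (subst (λ n → 3 * p ≤ 2 * n) length-V 3p≤2n) isRank)
       -- The width `r` dominates the cut-rank `r′` of the balanced edge.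
       (*-monoˡ-≤ (9 * suc k) (maximal r′ (a , b , a~b , isRank))))
  where
  open RankDecomposition D
  instance
    m≢0 : NonZero m
    m≢0 = >-nonZero (<⇒≤ 2≤m)
  V = points m (suc k)
  length-V : length V ≡ m ^ suc k
  length-V = length-points m (suc k)
  2≤n : 2 ≤ m ^ suc k
  2≤n = ≤-trans 2≤m (m≤m*n m (m ^ k) {{m^n≢0 m k}})
  -- A leaf carries a proof about its degree; equality proofs in ℕ are unique, so equal tree
  -- vertices give equal leaves.
  leaf-injective : ∀ {u v} → leaf u ≡ leaf v → u ≡ v
  leaf-injective {u} {v} eq = Bijection.injective leaves (leaf-≡ (Bijection.to leaves u) (Bijection.to leaves v) eq)
    where
    leaf-≡ : ∀ (x y : T.Leaf) → proj₁ x ≡ proj₁ y → x ≡ y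
    leaf-≡ (t , p) (.t , q) refl = cong (t ,_) (≡-irrelevant p q)

-- Passage to the rational inequality.

open import Data.Integer.Base using (+_)
import Data.Integer.Base as ℤ
import Data.Integer.Properties as ℤ
open import Data.Rational.Base using (_/_) renaming (_≤_ to _≤ℚ_)
import Data.Rational.Properties as ℚ
import Data.Rational.Unnormalised.Base as ℚᵘ
import Data.Rational.Unnormalised.Properties as ℚᵘ

corollary8 : (k m : ℕ) (2≤k : 2 ≤ k) (2≤m : 2 ≤ m) (r : ℕ) →
    IsRankWidth (hamming k m) r →
    (_/_ (+ (m ^ (k ∸ 1))) (9 * k) {{9*k≢0 2≤k}}) ≤ℚ (+ r / 1)
corollary8 (suc k) m 2≤k 2≤m r isRankWidth = ℚ.toℚᵘ-cancel-≤ (begin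
  _                  ≃⟨ ℚ.toℚᵘ-fromℚᵘ (ℚᵘ.mkℚᵘ (+ (m ^ k)) (pred (9 * suc k))) ⟩
  ℚᵘ.mkℚᵘ (+ (m ^ k)) (pred (9 * suc k))
    -- Unnormalised fractions are compared by cross-multiplication. `mkℚᵘ` stores the denominator
    -- minus one, hence `pred (9 * suc k)` on the left and 0 for the denominator 1.
    ≤⟨ ℚᵘ.*≤* (subst₂ ℤ._≤_ (ℤ.pos-* (m ^ k) 1) (ℤ.pos-* r (9 * suc k)) (ℤ.+≤+
         (≤-trans (≤-reflexive (*-identityʳ (m ^ k))) (hamming-rankWidth 2≤m isRankWidth)))) ⟩
  ℚᵘ.mkℚᵘ (+ r) 0    ≃⟨ ℚ.toℚᵘ-fromℚᵘ (ℚᵘ.mkℚᵘ (+ r) 0) ⟨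
  _                  ∎)
  where open ℚᵘ.≤-Reasoning
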